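{- Let $R$ be a relation on $X\times Y$, with both $X$ and $Y$ nonempty. If $R$ preserves attribute privacy and if every $x\in X$ is uniquely identifiable via $R$, then $\Phi_R$ contains no free faces.
   Context: Everything is finite. A relation $R$ on $X\times Y$ is a subset of $X\times Y$. $Y_x=\{y\in Y:(x,y)\in R\}$ and $X_y=\{x\in X:(x,y)\in R\}$. For $\sigma\subseteq X$, $\phi_R(\sigma)=\bigcap_{x\in\sigma}Y_x$ with $\phi_R(\emptyset)=Y$; for $\gamma\subseteq Y$, $\psi_R(\gamma)=\bigcap_{y\in\gamma}X_y$ with $\psi_R(\emptyset)=X$. $\Phi_R$ is the simplicial complex $\{\gamma\subseteq Y:\exists x\in X\ \forall y\in\gamma\ (x,y)\in R\}$, which contains $\emptyset$ as a simplex. $R$ preserves attribute privacy if $(\phi_R\circ\psi_R)(\gamma)=\gamma$ for all $\gamma\in\Phi_R$ (including $\gamma=\emptyset$). An individual $x\in X$ is uniquely identifiable via $R$ if $\psi_R(Y_x)=\{x\}$. A simplex of a simplicial complex is a free face if it is a proper subset of exactly one maximal simplex of the complex; the empty simplex may be a free face. -}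

module Defs where

open import Data.Fin.Base using (Fin)
open import Data.Fin.Subset using (Subset; _∈_; _⊆_; _⊂_; ⁅_⁆; ⋂)
open import Data.Fin.Subset.Properties using (_∈?_)
open import Data.List.Base using (map; filter; allFin)
open import Data.Nat.Base using (ℕ)
open import Data.Product using (∃; ∃!; _×_; _,_)
open import Data.Vec.Base using (tabulate)
open import Level using (Level; suc)
open import Relation.Binary.Core using (REL)
open import Relation.Binary.Definitions using (Decidable)
open import Relation.Binary.PropositionalEquality using (_≡_)
open import Relation.Nullary using (does)
open import Relation.Unary using (Pred)

record SimplicialComplex (n : ℕ) (ℓ : Level) : Set (suc ℓ) where
  field
    IsSimplex   : Pred (Subset n) ℓ
    down-closed : ∀ {σ τ} → σ ⊆ τ → IsSimplex τ → IsSimplex σ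

module _ {n : ℕ} {ℓ : Level} (K : SimplicialComplex n ℓ) where
  open SimplicialComplex K

  IsMaximal : Pred (Subset n) ℓ
  IsMaximal σ = IsSimplex σ × (∀ τ → IsSimplex τ → σ ⊆ τ → σ ≡ τ)

  IsFreeFace : Pred (Subset n) ℓ
  IsFreeFace σ = IsSimplex σ × ∃! _≡_ (λ τ → IsMaximal τ × σ ⊂ τ)

-- ⋂[ F ] σ is the intersection of the sets F i with i ∈ σ; an empty
-- intersection is the full subset.
⋂[_] : {m n : ℕ} → (Fin m → Subset n) → Subset m → Subset n
⋂[_] {m} F σ = ⋂ (map F (filter (_∈? σ) (allFin m)))

-- The finite sets X and Y are Fin m and Fin n.  Decidability of R makes its
-- rows and columns elements of Subset, so that equality of sets is _≡_.
module _ {m n : ℕ} {ℓ : Level} {R : REL (Fin m) (Fin n) ℓ} (R? : Decidable R) where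

  Y[_] : Fin m → Subset n
  Y[ x ] = tabulate (λ y → does (R? x y))

  X[_] : Fin n → Subset m
  X[ y ] = tabulate (λ x → does (R? x y))

  φ : Subset m → Subset n
  φ = ⋂[ Y[_] ]

  ψ : Subset n → Subset m
  ψ = ⋂[ X[_] ]

  Φ : SimplicialComplex n ℓ
  Φ = record
    { IsSimplex   = λ γ → ∃ λ x → ∀ y → y ∈ γ → R x y
    ; down-closed = λ { σ⊆τ (x , τ⊆Yx) → x , λ y y∈σ → τ⊆Yx y (σ⊆τ y∈σ) }
    }

  PreservesAttributePrivacy : Set ℓ
  PreservesAttributePrivacy =
    ∀ γ → SimplicialComplex.IsSimplex Φ γ → φ (ψ γ) ≡ γ

  UniquelyIdentifiable : Fin m → Set
  UniquelyIdentifiable x = ψ Y[ x ] ≡ ⁅ x ⁆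

{-# OPTIONS --safe #-}
-- Unique identifiability makes every row Y[ x ] a maximal simplex.  If γ is a
-- free face below the single maximal simplex τ, then every row containing γ
-- must equal τ, so φ (ψ γ) contains τ; attribute privacy then forces τ ⊆ γ.
module Submission where

open import Defs
open import Data.Fin.Base using (Fin)
open import Data.Fin.Subset using (Subset; _∈_; _⊆_; ⋂)
open import Data.Fin.Subset.Properties
  using (_∈?_; _⊂?_; ∈⊤; x∈p∩q⁺; x∈p∩q⁻; x∈⁅y⁆⇒x≡y; ⊆-antisym)
open import Data.List.Base using (allFin; filter; map; []; _∷_)
open import Data.List.Membership.Propositional.Properties using (∈-allFin; ∈-filter⁺)
open import Data.List.Relation.Unary.All as All using (All; []; _∷_)
import Data.List.Relation.Unary.All.Properties as All
open import Data.Nat.Base using (ℕ; NonZero)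
open import Data.Product using (_,_; proj₁; proj₂)
open import Data.Vec.Base using (tabulate)
open import Data.Vec.Properties using ([]=⇒lookup; lookup⇒[]=; lookup∘tabulate)
open import Level using (Level)
open import Relation.Binary.Core using (REL)
open import Relation.Binary.Definitions using (Decidable)
open import Relation.Binary.PropositionalEquality using (_≡_; sym; trans; subst)
open import Relation.Nullary using (¬_; does; yes; no)
open import Relation.Nullary.Decidable using (dec-true; decidable-stable)
import Relation.Unary as Unary

module _ {n : ℕ} where

  ∈-⋂⁺ : ∀ {x : Fin n} {ps} → All (x ∈_) ps → x ∈ ⋂ ps
  ∈-⋂⁺ []             = ∈⊤
  ∈-⋂⁺ (x∈p ∷ x∈ps) = x∈p∩q⁺ (x∈p , ∈-⋂⁺ x∈ps)

  ∈-⋂⁻ : ∀ {x : Fin n} ps → x ∈ ⋂ ps → All (x ∈_) ps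
  ∈-⋂⁻ []       _   = []
  ∈-⋂⁻ (p ∷ ps) x∈⋂ with x∈p , x∈⋂ps ← x∈p∩q⁻ p (⋂ ps) x∈⋂ = x∈p ∷ ∈-⋂⁻ ps x∈⋂ps

  module _ {m : ℕ} (F : Fin m → Subset n) {σ : Subset m} {x : Fin n} where

    ∈-⋂[]⁺ : (∀ {i} → i ∈ σ → x ∈ F i) → x ∈ ⋂[ F ] σ
    ∈-⋂[]⁺ x∈F = ∈-⋂⁺ (All.map⁺ (All.map x∈F (All.all-filter (_∈? σ) (allFin m))))

    ∈-⋂[]⁻ : x ∈ ⋂[ F ] σ → ∀ {i} → i ∈ σ → x ∈ F i
    ∈-⋂[]⁻ x∈⋂ {i} i∈σ =
      All.lookup (All.map⁻ (∈-⋂⁻ (map F (filter (_∈? σ) (allFin m))) x∈⋂))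
                 (∈-filter⁺ (_∈? σ) (∈-allFin i) i∈σ)

  module _ {p : Level} {P : Unary.Pred (Fin n) p} (P? : Unary.Decidable P) where

    ∈-tabulate⁺ : ∀ {x} → P x → x ∈ tabulate (λ y → does (P? y))
    ∈-tabulate⁺ {x} px =
      lookup⇒[]= x _ (trans (lookup∘tabulate _ x) (dec-true (P? x) px))

    ∈-tabulate⁻ : ∀ {x} → x ∈ tabulate (λ y → does (P? y)) → P x
    -- The equation mentions `does (P? x)`, so abstracting `P? x` along with it leaves
    -- `false ≡ true` in the `no` case.
    ∈-tabulate⁻ {x} x∈ with P? x | trans (sym (lookup∘tabulate (λ y → does (P? y)) x)) ([]=⇒lookup x∈)
    ... | yes px | _  = px
    ... | no  _  | ()

  module _ {ℓ : Level} (K : SimplicialComplex n ℓ) where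

    -- Uniqueness in `IsFreeFace` covers only proper inclusions `γ ⊂ σ`. If the inclusion is not
    -- proper, then `σ ⊆ γ ⊆ τ`, and the maximality of `σ` gives the equality instead.
    freeFace⇒maximal-unique : ∀ {γ σ} (free : IsFreeFace K γ) →
                              IsMaximal K σ → γ ⊆ σ → proj₁ (proj₂ free) ≡ σ
    freeFace⇒maximal-unique {γ} {σ} (_ , τ , ((τ-simplex , _) , γ⊂τ) , unique) σ-max γ⊆σ
      with γ ⊂? σ
    ... | yes γ⊂σ = unique (σ-max , γ⊂σ)
    ... | no  γ⊄σ = sym (proj₂ σ-max τ τ-simplex (λ z∈σ → proj₁ γ⊂τ (σ⊆γ z∈σ)))
      where
      -- `γ⊄σ` only refutes a point of `σ` outside `γ`; decidable membership turns this into an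
      -- inclusion.
      σ⊆γ : σ ⊆ γ
      σ⊆γ {z} z∈σ = decidable-stable (z ∈? γ) λ z∉γ → γ⊄σ (γ⊆σ , z , z∈σ , z∉γ)

module _ {m n : ℕ} {ℓ : Level} {R : REL (Fin m) (Fin n) ℓ} (R? : Decidable R) where

  -- A simplex `τ` above the row of `x` lies in the row of some `x′`. Then `x′` has every attribute
  -- of `x`, so `x′` belongs to `ψ Y[ x ]`, which is the singleton of `x`; hence `τ` lies in the row
  -- of `x` itself.
  uniquelyIdentifiable⇒maximal : ∀ {x} → UniquelyIdentifiable R? x →
                                 IsMaximal (Φ R?) (Y[_] R? x)
  uniquelyIdentifiable⇒maximal {x} ui = (x , λ _ → ∈-tabulate⁻ (R? x)) , maximal
    where
    maximal : ∀ τ → SimplicialComplex.IsSimplex (Φ R?) τ → Y[_] R? x ⊆ τ → Y[_] R? x ≡ τ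
    maximal τ (x′ , τ⊆Yx′) Yx⊆τ = ⊆-antisym Yx⊆τ λ {y} y∈τ →
      ∈-tabulate⁺ (R? x) (subst (λ z → R z y) x′≡x (τ⊆Yx′ y y∈τ))
      where
      x′∈ψYx : x′ ∈ ψ R? (Y[_] R? x)
      x′∈ψYx = ∈-⋂[]⁺ (X[_] R?) λ {y} y∈Yx →
        ∈-tabulate⁺ (λ z → R? z y) (τ⊆Yx′ y (Yx⊆τ y∈Yx))

      x′≡x : x′ ≡ x
      x′≡x = x∈⁅y⁆⇒x≡y x (subst (x′ ∈_) ui x′∈ψYx)

  -- One half of the Galois connection: the same instance of `R` is read first in a column, then in
  -- a row.
  ∈-ψ⇒⊆-row : ∀ {γ x} → x ∈ ψ R? γ → γ ⊆ Y[_] R? x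
  ∈-ψ⇒⊆-row {x = x} x∈ψγ {y} y∈γ =
    ∈-tabulate⁺ (R? x) (∈-tabulate⁻ (λ z → R? z y) (∈-⋂[]⁻ (X[_] R?) x∈ψγ y∈γ))

lemma63 : {ℓ : Level} (m n : ℕ) .{{_ : NonZero m}} .{{_ : NonZero n}}
    (R : REL (Fin m) (Fin n) ℓ) (R? : Decidable R) →
    PreservesAttributePrivacy R? →
    (∀ x → UniquelyIdentifiable R? x) →
    ∀ γ → ¬ IsFreeFace (Φ R?) γ
lemma63 m n R R? privacy ui γ free@(γ-simplex , τ , (_ , _ , z , z∈τ , z∉γ) , _) =
  z∉γ (subst (z ∈_) (privacy γ γ-simplex) z∈φψγ)
  where
  -- `z` is the point of `τ` outside `γ` that the strictness of `γ ⊂ τ` supplies. Each `x` in `ψ γ`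
  -- has `τ` as its row, so `z` survives the intersection of these rows.
  z∈φψγ : z ∈ φ R? (ψ R? γ)
  z∈φψγ = ∈-⋂[]⁺ (Y[_] R?) λ {x} x∈ψγ →
    subst (z ∈_)
      (freeFace⇒maximal-unique (Φ R?) free
        (uniquelyIdentifiable⇒maximal R? (ui x)) (∈-ψ⇒⊆-row R? x∈ψγ))
      z∈τ
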